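{- For every integer $g \ge 0$, let $n'_g$ denote the number of gapsets of genus $g$ and depth at most $3$ (equivalently, the number of numerical semigroups $S$ of genus $g$ whose conductor $c$ and multiplicity $m$ satisfy $c \le 3m$). Then for all $g \ge 3$, $$n'_{g-1}+n'_{g-2} \,\le\, n'_{g} \,\le\, n'_{g-1}+n'_{g-2}+n'_{g-3}.$$
   Context: A gapset is a finite set $G \subset \mathbb{N}_+=\{1,2,3,\dots\}$ such that for all $z \in G$, whenever $z=x+y$ with $x,y\in\mathbb{N}_+$, we have $x\in G$ or $y\in G$; equivalently $G=\mathbb{N}\setminus S$ for a numerical semigroup $S$. The multiplicity of $G$ is the least $m\ge 1$ with $m\notin G$; its Frobenius number is $f=\max G$ (and $f=-1$ if $G=\emptyset$); its conductor is $c=f+1$; its genus is $|G|$; its depth is $q=\lceil c/m\rceil$. -}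

module Defs where

open import Data.Nat.Base
open import Data.Nat.Properties
open import Data.Nat.DivMod using (_/_; /-monoˡ-≤; m*n/n≡m; m<n*o⇒m/o<n)
open import Data.Integer.Base as ℤ using (ℤ; +_; -1ℤ; 1ℤ; ∣_∣)
open import Data.Fin.Base using (Fin; toℕ)
open import Data.Fin.Properties using (toℕ<n; toℕ-injective; injective⇒≤)
open import Data.List.Base using (List; []; _∷_; _++_; map; filter; length; lookup)
open import Data.List.Properties using (∷-injectiveʳ)
open import Data.List.Extrema.Nat using (max; xs≤max; ⊥≤max)
open import Data.List.Membership.Propositional using (_∈_; _∉_)
open import Data.List.Membership.DecPropositional _≟_ using (_∈?_)
open import Data.List.Membership.Propositional.Properties
  using (∈-map⁺; ∈-map⁻; ∈-++⁺ˡ; ∈-++⁺ʳ; ∈-++⁻; ∈-filter⁺; ∈-filter⁻)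
open import Data.List.Relation.Unary.Any using (here; there; index)
open import Data.List.Relation.Unary.Any.Properties using (lookup-index)
import Data.List.Relation.Unary.All as All
open import Data.List.Relation.Unary.All using (All; []; _∷_)
import Data.List.Relation.Unary.AllPairs as AllPairs
open import Data.List.Relation.Unary.AllPairs using (AllPairs; []; _∷_)
open import Data.List.Relation.Unary.Unique.Propositional using (Unique)
import Data.List.Relation.Unary.Unique.Propositional.Properties as Unique
open import Data.Product.Base using (_×_; _,_; proj₁; proj₂)
open import Data.Sum.Base using (_⊎_; inj₁; inj₂)
open import Function.Base using (_∘_)
open import Function.Bundles using (_⇔_; mk⇔; module Equivalence)
open import Relation.Binary.PropositionalEquality
open import Relation.Nullary.Decidable using (Dec; yes; no; map′; _×-dec_; _⊎-dec_; _→-dec_)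
open import Relation.Nullary.Negation using (contradiction)

-- A finite subset of ℕ₊ is represented by the strictly increasing list of its
-- elements, so that distinct lists are distinct sets.
record IsGapset (G : List ℕ) : Set where
  constructor mkIsGapset
  field
    increasing : AllPairs _<_ G
    positive   : All (1 ≤_) G
    splits     : ∀ {z} → z ∈ G → ∀ x y → 1 ≤ x → 1 ≤ y → z ≡ x + y → x ∈ G ⊎ y ∈ G

genus : List ℕ → ℕ
genus = length

frobenius : List ℕ → ℤ
frobenius []       = -1ℤ
frobenius (x ∷ xs) = + max x xs

-- frobenius G + 1 is never negative for any list of naturals, so the absolute
-- value only serves to view it as a natural number.
conductor : List ℕ → ℕ
conductor G = ∣ frobenius G ℤ.+ 1ℤ ∣

-- Searches k, k + 1, … for a number whose successor is not in G, giving up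
-- after the given number of steps.
search : List ℕ → ℕ → ℕ → ℕ
search G zero       k = k
search G (suc fuel) k with suc k ∈? G
... | yes _ = search G fuel (suc k)
... | no  _ = k

-- The least m ≥ 1 outside G; see multiplicity-∉ and multiplicity-least. Since
-- every element of G is < conductor G, the search does not run out of steps.
multiplicity : List ℕ → ℕ
multiplicity G = suc (search G (conductor G) 0)

-- ⌈ c / m ⌉ computed as ⌊ (c + (m - 1)) / m ⌋.
depth : List ℕ → ℕ
depth G = (conductor G + pred (multiplicity G)) / multiplicity G

------------------------------------------------------------------------

∈⇒<conductor : ∀ {G z} → z ∈ G → z < conductor G
∈⇒<conductor {x ∷ xs} (here refl) rewrite +-comm (max x xs) 1 = s≤s (⊥≤max x xs)
∈⇒<conductor {x ∷ xs} (there z∈)  rewrite +-comm (max x xs) 1 =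
  s≤s (All.lookup (xs≤max x xs) z∈)

search-∉ : ∀ G fuel k → conductor G ≤ fuel + k → suc (search G fuel k) ∉ G
search-∉ G zero       k c≤ k∈ = <⇒≱ (∈⇒<conductor k∈) (m≤n⇒m≤1+n c≤)
search-∉ G (suc fuel) k c≤ with suc k ∈? G
... | yes _ = search-∉ G fuel (suc k) (subst (conductor G ≤_) (sym (+-suc fuel k)) c≤)
... | no k∉ = k∉

search-least : ∀ G fuel k → (∀ j → j < k → suc j ∈ G) →
               ∀ j → j < search G fuel k → suc j ∈ G
search-least G zero       k below = below
search-least G (suc fuel) k below with suc k ∈? G
... | no  _  = below
... | yes k∈ = search-least G fuel (suc k) below′
  where
  below′ : ∀ j → j < suc k → suc j ∈ G
  below′ j j<1+k with m≤n⇒m<n∨m≡n (s≤s⁻¹ j<1+k)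
  ... | inj₁ j<k  = below j j<k
  ... | inj₂ refl = k∈

multiplicity-∉ : ∀ G → multiplicity G ∉ G
multiplicity-∉ G = search-∉ G (conductor G) 0 (≤-reflexive (sym (+-identityʳ _)))

multiplicity-least : ∀ G k → 1 ≤ k → k < multiplicity G → k ∈ G
multiplicity-least G (suc k) _ (s≤s k<) = search-least G (conductor G) 0 (λ _ ()) k k<

multiplicity≤1+genus : ∀ G → multiplicity G ≤ suc (genus G)
multiplicity≤1+genus G = s≤s (injective⇒≤ {f = pos} pos-injective)
  where
  mem : (i : Fin (pred (multiplicity G))) → suc (toℕ i) ∈ G
  mem i = multiplicity-least G (suc (toℕ i)) (s≤s z≤n) (s≤s (toℕ<n i))
  pos : Fin (pred (multiplicity G)) → Fin (length G)
  pos i = index (mem i)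
  pos-injective : ∀ {i j} → pos i ≡ pos j → i ≡ j
  pos-injective {i} {j} eq = toℕ-injective (suc-injective
    (trans (lookup-index (mem i)) (trans (cong (lookup G) eq) (sym (lookup-index (mem j))))))

depth≤⇔ : ∀ G q → depth G ≤ q ⇔ conductor G ≤ q * multiplicity G
depth≤⇔ G q = mk⇔ to from
  where
  c = conductor G
  k = pred (multiplicity G)
  m = suc k
  to : (c + k) / m ≤ q → c ≤ q * m
  to d≤q = ≮⇒≥ λ qm<c → <⇒≱ {q} {(c + k) / m} (subst (_≤ (c + k) / m) (m*n/n≡m (suc q) m)
    (/-monoˡ-≤ m (subst (_≤ c + k) (cong suc (+-comm (q * m) k))
      (+-monoˡ-≤ k qm<c)))) d≤q
  from : c ≤ q * m → (c + k) / m ≤ q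
  from c≤ = s≤s⁻¹ (m<n*o⇒m/o<n {n = suc q}
    (s≤s (subst (_≤ k + q * m) (+-comm k c) (+-monoʳ-≤ k c≤))))

isGapset? : ∀ G → Dec (IsGapset G)
isGapset? G = map′
  (λ (inc , pos , s) → mkIsGapset inc pos (to s))
  (λ γ → let open IsGapset γ in increasing , positive , from splits)
  (AllPairs.allPairs? _<?_ G ×-dec All.all? (1 ≤?_) G ×-dec All.all? bounded? G)
  where
  Bounded : ℕ → Set
  Bounded z = ∀ {x} → x < z → 1 ≤ x → x ∈ G ⊎ z ∸ x ∈ G
  bounded? : ∀ z → Dec (Bounded z)
  bounded? z = allUpTo? (λ x → (1 ≤? x) →-dec ((x ∈? G) ⊎-dec (z ∸ x ∈? G))) z
  to : All Bounded G → ∀ {z} → z ∈ G → ∀ x y → 1 ≤ x → 1 ≤ y → z ≡ x + y → x ∈ G ⊎ y ∈ G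
  to s z∈ x y 1≤x 1≤y refl =
    subst (λ w → x ∈ G ⊎ w ∈ G) (m+n∸m≡n x y) (All.lookup s z∈ (m<m+n x 1≤y) 1≤x)
  from : (∀ {z} → z ∈ G → ∀ x y → 1 ≤ x → 1 ≤ y → z ≡ x + y → x ∈ G ⊎ y ∈ G) → All Bounded G
  from s = All.tabulate λ {z} z∈ {x} x<z 1≤x →
    s z∈ x (z ∸ x) 1≤x (m<n⇒0<n∸m x<z) (sym (m+[n∸m]≡n (<⇒≤ x<z)))

------------------------------------------------------------------------

-- All strictly increasing lists with entries in {k, …, k + n - 1}.
increasingLists : ℕ → ℕ → List (List ℕ)
increasingLists k zero    = [] ∷ []
increasingLists k (suc n) =
  map (k ∷_) (increasingLists (suc k) n) ++ increasingLists (suc k) n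

increasingLists-≥ : ∀ k n {G} → G ∈ increasingLists k n → All (k ≤_) G
increasingLists-≥ k zero    (here refl) = []
increasingLists-≥ k (suc n) G∈ with ∈-++⁻
                                (map (k ∷_) (increasingLists (suc k) n)) G∈
... | inj₂ G∈ʳ = All.map <⇒≤ (increasingLists-≥ (suc k) n G∈ʳ)
... | inj₁ G∈ˡ with ∈-map⁻ (k ∷_) G∈ˡ
...   | _ , H∈ , refl = ≤-refl ∷ All.map <⇒≤ (increasingLists-≥ (suc k) n H∈)

increasingLists-unique : ∀ k n → Unique (increasingLists k n)
increasingLists-unique k zero    = [] ∷ []
increasingLists-unique k (suc n) =
  Unique.++⁺ (Unique.map⁺ ∷-injectiveʳ rec) rec disjoint
  where
  rec = increasingLists-unique (suc k) n
  disjoint : ∀ {G} → G ∈ map (k ∷_) (increasingLists (suc k) n) ×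
                     G ∈ increasingLists (suc k) n → _
  disjoint (l , r) with ∈-map⁻ (k ∷_) l
  ... | _ , _ , refl = 1+n≰n (All.head (increasingLists-≥ (suc k) n r))

increasingLists-complete : ∀ k n {G} → AllPairs _<_ G → All (k ≤_) G → All (_< k + n) G →
                           G ∈ increasingLists k n
increasingLists-complete k zero    []        []       []       = here refl
increasingLists-complete k zero    (_ ∷ _)   (k≤x ∷ _) (x<k ∷ _) =
  contradiction k≤x (<⇒≱ (subst (_ <_) (+-identityʳ k) x<k))
increasingLists-complete k (suc n) {[]}    _ _ _ =
  ∈-++⁺ʳ _ (increasingLists-complete (suc k) n [] [] [])
increasingLists-complete k (suc n) {x ∷ G} (x<G ∷ inc) (k≤x ∷ _) (x<b ∷ G<b)
  with m≤n⇒m<n∨m≡n k≤x | All.map (λ {y} → subst (y <_) (+-suc k n)) (x<b ∷ G<b)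
... | inj₁ k<x  | b = ∈-++⁺ʳ _
  (increasingLists-complete (suc k) n (x<G ∷ inc) (k<x ∷ All.map (<-trans k<x) x<G) b)
... | inj₂ refl | _ ∷ b = ∈-++⁺ˡ
  (∈-map⁺ (k ∷_) (increasingLists-complete (suc k) n inc x<G b))

IsCounted : ℕ → List ℕ → Set
IsCounted g G = IsGapset G × genus G ≡ g × depth G ≤ 3

isCounted? : ∀ g G → Dec (IsCounted g G)
isCounted? g G = isGapset? G ×-dec (genus G ≟ g) ×-dec (depth G ≤? 3)

-- The gapsets of genus g and depth at most 3. The bound on their entries is
-- justified by c ≤ 3m and m ≤ g + 1, and loses nothing by ∈-gapsetsDepth≤3⇔.
gapsetsDepth≤3 : ℕ → List (List ℕ)
gapsetsDepth≤3 g = filter (isCounted? g) (increasingLists 1 (3 * suc g))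

gapsetsDepth≤3-unique : ∀ g → Unique (gapsetsDepth≤3 g)
gapsetsDepth≤3-unique g = Unique.filter⁺ (isCounted? g) (increasingLists-unique 1 (3 * suc g))

∈-gapsetsDepth≤3⇔ : ∀ g G → G ∈ gapsetsDepth≤3 g ⇔ (IsGapset G × genus G ≡ g × depth G ≤ 3)
∈-gapsetsDepth≤3⇔ g G = mk⇔
  (λ G∈ → proj₂ (∈-filter⁻ (isCounted? g) {xs = increasingLists 1 (3 * suc g)} G∈))
  (λ p → ∈-filter⁺ (isCounted? g) (complete p) p)
  where
  complete : IsCounted g G → G ∈ increasingLists 1 (3 * suc g)
  complete (γ , refl , d≤3) = increasingLists-complete 1 _ increasing positive
    (All.tabulate λ z∈ → m≤n⇒m≤1+n (≤-trans (∈⇒<conductor z∈)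
      (≤-trans (Equivalence.to (depth≤⇔ G 3) d≤3)
               (*-monoʳ-≤ 3 (multiplicity≤1+genus G)))))
    where open IsGapset γ

n' : ℕ → ℕ
n' g = length (gapsetsDepth≤3 g)

{-# OPTIONS --safe #-}
module Submission where

-- A gapset of multiplicity m and depth at most 3 is determined by the word
-- w₁ … w_{m-1} in which w_i ∈ {1, 2, 3} counts its elements congruent to i
-- modulo m, and its genus is the sum of the letters. Such a word comes from a
-- gapset iff w_{i+j} ≤ w_i + w_j whenever i + j < m: the other condition,
-- w_{i+j-m} ≤ w_i + w_j + 1, is automatic because no letter exceeds 3. The class
-- of these words is closed under deleting the last letter, which gives the upper
-- bound, and under appending 1 or 2, which gives the lower bound.

open import Defs
open import Data.Nat.Base using (ℕ; _+_; _∸_; _≤_)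
open import Data.Product.Base using (_×_)

open import Data.List.Base
  using (List; []; _∷_; _++_; map; filter; length; upTo)
open import Data.List.Properties
  using (∷-injectiveʳ; length-map; length-++; length-++-sucʳ; length-filter; length-upTo)
open import Data.List.Extrema.Nat using (max; max<v⁺)
open import Data.List.Membership.Propositional using (_∈_; _∉_)
open import Data.List.Membership.Propositional.Properties
open import Data.List.Relation.Unary.All as All using (All; []; _∷_)
open import Data.List.Relation.Unary.AllPairs as AllPairs using (AllPairs; []; _∷_)
import Data.List.Relation.Unary.AllPairs.Properties as AllPairsₚ
open import Data.List.Relation.Unary.Any using (here; there)
open import Data.List.Relation.Unary.Unique.Propositional using (Unique)
import Data.List.Relation.Unary.Unique.Propositional.Properties as Unique
open import Data.List.Relation.Binary.Subset.Propositional using (_⊆_)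
open import Data.Nat.Base hiding (ℕ; _+_; _∸_; _≤_)
open import Data.Nat.DivMod
open import Data.Nat.Divisibility using (n∣m*n)
open import Data.Nat.ListAction using (sum)
open import Data.Nat.Properties
open import Algebra.Properties.CommutativeSemigroup +-commutativeSemigroup using (interchange)
open import Data.List.Membership.DecPropositional _≟_ using (_∈?_)
open import Data.Product.Base using (∃-syntax; _,_; proj₁; proj₂)
open import Data.Sum.Base using (_⊎_; inj₁; inj₂; [_,_]′)
open import Function.Base using (id; _∘_)
open import Function.Bundles using (_⇔_; mk⇔; module Equivalence)
open import Relation.Binary.Definitions using (tri<; tri≈; tri>)
open import Relation.Binary.PropositionalEquality
open import Relation.Nullary.Decidable using (Dec; yes; no; map′; _×-dec_)
open import Relation.Nullary.Negation using (¬_; contradiction)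
open import Relation.Unary using (Decidable)

open Equivalence using (to; from)

-- Lists and finite sets

-- Cutting `f x` out of `ys` leaves room for the images of the remaining elements, which differ from
-- `f x`. Injectivity is asked only on members of `xs` because `gaps` is not injective on arbitrary
-- lists.
length-≤-injection : ∀ {A B : Set} (f : A → B) {xs ys} → Unique xs →
                     (∀ {x} → x ∈ xs → f x ∈ ys) →
                     (∀ {x y} → x ∈ xs → y ∈ xs → f x ≡ f y → x ≡ y) →
                     length xs ≤ length ys
length-≤-injection f []                     image injective = z≤n
length-≤-injection f {x ∷ xs} (x∉xs ∷ uniq) image injective
  with as , bs , refl ← ∈-∃++ (image (here refl)) =
  subst (suc (length xs) ≤_) (sym (length-++-sucʳ as (f x) bs))
    (s≤s (length-≤-injection f uniq image′ (λ y∈ z∈ → injective (there y∈) (there z∈))))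
  where
  image′ : ∀ {y} → y ∈ xs → f y ∈ as ++ bs
  image′ y∈ with ∈-++⁻ as (image (there y∈))
  ... | inj₁ fy∈as         = ∈-++⁺ˡ fy∈as
  ... | inj₂ (there fy∈bs) = ∈-++⁺ʳ as fy∈bs
  ... | inj₂ (here fy≡fx)  =
    contradiction (injective (here refl) (there y∈) (sym fy≡fx)) (All.lookup x∉xs y∈)

length-≤-⊆ : ∀ {A : Set} {xs ys : List A} → Unique xs → xs ⊆ ys → length xs ≤ length ys
length-≤-⊆ uniq xs⊆ys = length-≤-injection id uniq xs⊆ys (λ _ _ → id)

increasing-ext : ∀ {xs ys} → AllPairs _<_ xs → AllPairs _<_ ys → xs ⊆ ys → ys ⊆ xs → xs ≡ ys
increasing-ext {[]}     {[]}     _ _ _ _ = refl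
increasing-ext {[]}     {_ ∷ _}  _ _ _ ys⊆ with () ← ys⊆ (here refl)
increasing-ext {_ ∷ _}  {[]}     _ _ xs⊆ _ with () ← xs⊆ (here refl)
increasing-ext {x ∷ xs} {y ∷ ys} (x< ∷ incx) (y< ∷ incy) xs⊆ ys⊆ =
  cong₂ _∷_ x≡y (increasing-ext incx incy (tail x< xs⊆ x≡y) (tail y< ys⊆ (sym x≡y)))
  where
  head≤ : ∀ {a b : ℕ} {bs} → All (b <_) bs → a ∈ b ∷ bs → b ≤ a
  head≤ b< (here refl) = ≤-refl
  head≤ b< (there a∈)  = <⇒≤ (All.lookup b< a∈)
  x≡y : x ≡ y
  x≡y = ≤-antisym (head≤ x< (ys⊆ (here refl))) (head≤ y< (xs⊆ (here refl)))
  tail : ∀ {a b : ℕ} {as bs} → All (a <_) as → a ∷ as ⊆ b ∷ bs → a ≡ b → as ⊆ bs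
  tail a< as⊆ refl c∈ with as⊆ (there c∈)
  ... | here refl  = contradiction (All.lookup a< c∈) (<-irrefl refl)
  ... | there c∈bs = c∈bs

-- Used with `P k` saying that `r + k * m` lies in a gapset; the threshold `t` then becomes the
-- letter at `r`.
initial-segment : ∀ {P : ℕ → Set} → Decidable P → (∀ {k} → P (suc k) → P k) →
                  ∀ q → ¬ P q → ∃[ t ] t ≤ q × (∀ {k} → P k ⇔ k < t)
initial-segment {P} P? down zero    ¬P0 =
  0 , z≤n , mk⇔ (λ Pk → contradiction (downTo0 Pk) ¬P0) (λ ())
  where
  downTo0 : ∀ {k} → P k → P 0
  downTo0 {zero}  = id
  downTo0 {suc k} = downTo0 ∘ down
initial-segment {P} P? down (suc q) ¬P1+q with P? q
... | no ¬Pq = let t , t≤q , P⇔ = initial-segment P? down q ¬Pq in t , m≤n⇒m≤1+n t≤q , P⇔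
... | yes Pq = suc q , ≤-refl ,
  mk⇔ (λ Pk → ≰⇒> λ q<k → ¬P1+q (below Pk (≤⇒≤′ q<k))) (λ k≤q → below Pq (≤⇒≤′ (s≤s⁻¹ k≤q)))
  where
  below : ∀ {j k} → P k → j ≤′ k → P j
  below Pk ≤′-refl       = Pk
  below Pk (≤′-step j≤k) = below (down Pk) j≤k

-- Division with remainder; recognizing the conductor and the multiplicity.

[r+k*m]%m≡r : ∀ {r m} k .{{_ : NonZero m}} → r < m → (r + k * m) % m ≡ r
[r+k*m]%m≡r {r} {m} k r<m = trans ([m+kn]%n≡m%n r k m) (m<n⇒m%n≡m r<m)

[r+k*m]/m≡k : ∀ {r m} k .{{_ : NonZero m}} → r < m → (r + k * m) / m ≡ k
[r+k*m]/m≡k {r} {m} k r<m = trans (+-distrib-/-∣ʳ r (n∣m*n k))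
  (cong₂ _+_ (m<n⇒m/n≡0 r<m) (m*n/n≡m k m))

conductor-≤ : ∀ G {N} → (∀ {z} → z ∈ G → z < N) → conductor G ≤ N
conductor-≤ []       _     = z≤n
conductor-≤ (x ∷ xs) bound rewrite +-comm (max x xs) 1 =
  max<v⁺ {xs = xs} (bound (here refl)) (All.tabulate (bound ∘ there))

multiplicity-unique : ∀ G {m} → 1 ≤ m → m ∉ G → (∀ k → 1 ≤ k → k < m → k ∈ G) →
                      multiplicity G ≡ m
multiplicity-unique G 1≤m m∉ least = ≤-antisym
  (≮⇒≥ λ m<μ → m∉ (multiplicity-least G _ 1≤m m<μ))
  (≮⇒≥ λ μ<m → multiplicity-∉ G (least _ (s≤s z≤n) μ<m))

-- Words and their coordinates

-- A word w₁ … w_n is stored as w_n ∷ … ∷ w₁ ∷ [], and coord w i is w_i, extended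
-- by 0 to i = 0 and i > n.
coord : List ℕ → ℕ → ℕ
coord []      i = 0
coord (a ∷ w) i with i ≟ suc (length w)
... | yes _ = a
... | no  _ = coord w i

coord-last : ∀ a w → coord (a ∷ w) (suc (length w)) ≡ a
coord-last a w with suc (length w) ≟ suc (length w)
... | yes _ = refl
... | no ≢l = contradiction refl ≢l

coord-init : ∀ a w {i} → i ≢ suc (length w) → coord (a ∷ w) i ≡ coord w i
coord-init a w {i} i≢ with i ≟ suc (length w)
... | yes i≡ = contradiction i≡ i≢
... | no _   = refl

coord-zero : ∀ w → coord w 0 ≡ 0
coord-zero []      = refl
coord-zero (a ∷ w) = trans (coord-init a w (λ ())) (coord-zero w)

coord-beyond : ∀ w {i} → length w < i → coord w i ≡ 0
coord-beyond []      _ = refl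
coord-beyond (a ∷ w) l<i =
  trans (coord-init a w (>⇒≢ l<i)) (coord-beyond w (<⇒≤ l<i))

coord-within : ∀ w {i k} → k < coord w i → i ≤ length w
coord-within w k< = ≮⇒≥ λ l<i → n≮0 (subst (_ <_) (coord-beyond w l<i) k<)

coord-ext : ∀ v w → length v ≡ length w → (∀ i → coord v i ≡ coord w i) → v ≡ w
coord-ext []      []      _  _ = refl
coord-ext (a ∷ v) (b ∷ w) l≡ c≡ = cong₂ _∷_ a≡b (coord-ext v w l≡′ c≡′)
  where
  l≡′ = suc-injective l≡
  a≡b : a ≡ b
  a≡b = begin
    a                             ≡⟨ coord-last a v ⟨
    coord (a ∷ v) (suc (length v)) ≡⟨ c≡ (suc (length v)) ⟩
    coord (b ∷ w) (suc (length v)) ≡⟨ cong (coord (b ∷ w) ∘ suc) l≡′ ⟩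
    coord (b ∷ w) (suc (length w)) ≡⟨ coord-last b w ⟩
    b                             ∎ where open ≡-Reasoning
  c≡′ : ∀ i → coord v i ≡ coord w i
  c≡′ i with i ≟ suc (length v)
  -- At the position of the removed letters both shorter words have coordinate 0.
  ... | yes refl = trans (coord-beyond v ≤-refl) (sym (coord-beyond w (≤-reflexive (cong suc (sym l≡′)))))
  ... | no  i≢   = begin
    coord v i       ≡⟨ coord-init a v i≢ ⟨
    coord (a ∷ v) i ≡⟨ c≡ i ⟩
    coord (b ∷ w) i ≡⟨ coord-init b w (λ i≡ → i≢ (trans i≡ (cong suc (sym l≡′)))) ⟩
    coord w i       ∎ where open ≡-Reasoning

word : (ℕ → ℕ) → ℕ → List ℕ
word f zero    = []
word f (suc n) = f (suc n) ∷ word f n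

length-word : ∀ f n → length (word f n) ≡ n
length-word f zero    = refl
length-word f (suc n) = cong suc (length-word f n)

coord-word : ∀ f n {i} → 1 ≤ i → i ≤ n → coord (word f n) i ≡ f i
coord-word f zero    1≤i i≤0 = contradiction (≤-trans 1≤i i≤0) (λ ())
coord-word f (suc n) {i} 1≤i i≤1+n with i ≟ suc (length (word f n))
... | yes i≡ = cong f (sym (trans i≡ (cong suc (length-word f n))))
... | no  i≢ = coord-word f n 1≤i (s≤s⁻¹ (≤∧≢⇒< i≤1+n λ i≡ →
  i≢ (trans i≡ (cong suc (sym (length-word f n))))))

-- Kunz words: bounded letters and subadditivity.

Letters : List ℕ → Set
Letters = All (λ a → 1 ≤ a × a ≤ 3)

letters-word : ∀ f n → (∀ i → 1 ≤ i → i ≤ n → 1 ≤ f i × f i ≤ 3) → Letters (word f n)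
letters-word f zero    _     = []
letters-word f (suc n) bound =
  bound (suc n) (s≤s z≤n) ≤-refl ∷ letters-word f n (λ i 1≤i i≤n → bound i 1≤i (m≤n⇒m≤1+n i≤n))

1≤coord : ∀ {w} → Letters w → ∀ {i} → 1 ≤ i → i ≤ length w → 1 ≤ coord w i
1≤coord []                    1≤i i≤0 = contradiction (≤-trans 1≤i i≤0) (λ ())
1≤coord {a ∷ w} ((1≤a , _) ∷ L) {i} 1≤i i≤ with i ≟ suc (length w)
... | yes _ = 1≤a
... | no i≢ = 1≤coord L 1≤i (s≤s⁻¹ (≤∧≢⇒< i≤ i≢))

coord≤3 : ∀ {w} → Letters w → ∀ i → coord w i ≤ 3
coord≤3 []                      i = z≤n
coord≤3 {a ∷ w} ((_ , a≤3) ∷ L) i with i ≟ suc (length w)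
... | yes _ = a≤3
... | no  _ = coord≤3 L i

-- No range is imposed on `i` and `j`: the left side is 0 once `i + j` exceeds the length, and the
-- inequality is trivial when `i` or `j` is 0.
Subadditive : List ℕ → Set
Subadditive w = ∀ i j → coord w (i + j) ≤ coord w i + coord w j

Kunz : List ℕ → Set
Kunz w = Letters w × Subadditive w

-- As long as `i + j` stays within `w`, none of the three coordinates sees the deleted letter.
kunz-init : ∀ {a w} → Kunz (a ∷ w) → Kunz w
kunz-init {a} {w} (_ ∷ L , sub) = L , sub′
  where
  sub′ : Subadditive w
  sub′ i j with i + j ≤? length w
  ... | no  i+j≰l = ≤-trans (≤-reflexive (coord-beyond w (≰⇒> i+j≰l))) z≤n
  ... | yes i+j≤l = subst₂ _≤_ (init i+j≤l)
    (cong₂ _+_ (init (m+n≤o⇒m≤o i i+j≤l)) (init (m+n≤o⇒n≤o i i+j≤l))) (sub i j)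
    where
    init : ∀ {k} → k ≤ length w → coord (a ∷ w) k ≡ coord w k
    init k≤ = coord-init a w (<⇒≢ (s≤s k≤))

-- The only new constraints have `i + j` at the appended position, and there `a ≤ 2 ≤ w_i + w_j`
-- since letters are at least 1.
kunz-cons : ∀ {a w} → 1 ≤ a → a ≤ 2 → Kunz w → Kunz (a ∷ w)
kunz-cons {a} {w} 1≤a a≤2 (L , sub) = L′ , sub′
  where
  L′ : Letters (a ∷ w)
  L′ = (1≤a , m≤n⇒m≤1+n a≤2) ∷ L
  sub′ : Subadditive (a ∷ w)
  sub′ zero    j = m≤n+m _ _
  sub′ (suc i) zero rewrite +-identityʳ i = m≤m+n _ _
  sub′ i@(suc _) j@(suc _) with <-cmp (i + j) (suc (length w))
  ... | tri> _ _ i+j> = ≤-trans (≤-reflexive (coord-beyond (a ∷ w) i+j>)) z≤n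
  ... | tri≈ _ i+j≡ _ = begin
    coord (a ∷ w) (i + j)           ≡⟨ cong (coord (a ∷ w)) i+j≡ ⟩
    coord (a ∷ w) (suc (length w))  ≡⟨ coord-last a w ⟩
    a                               ≤⟨ a≤2 ⟩
    1 + 1                           ≤⟨ +-mono-≤
      (1≤coord L′ (s≤s z≤n) (≤-trans (m≤m+n i j) (≤-reflexive i+j≡)))
      (1≤coord L′ (s≤s z≤n) (≤-trans (m≤n+m j i) (≤-reflexive i+j≡))) ⟩
    coord (a ∷ w) i + coord (a ∷ w) j ∎ where open ≤-Reasoning
  ... | tri< i+j< _ _ = subst₂ _≤_ (sym (init i+j<))
    (sym (cong₂ _+_ (init (≤-<-trans (m≤m+n i j) i+j<)) (init (≤-<-trans (m≤n+m j i) i+j<)))) (sub i j)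
    where
    init : ∀ {k} → k < suc (length w) → coord (a ∷ w) k ≡ coord w k
    init k< = coord-init a w (<⇒≢ k<)

-- From words to gapsets

-- With `m = suc (length w)`, the gaps congruent to `r` are the first `w_r` numbers of the class
-- `r, r + m, r + 2m, …`. Class 0 has none, as `coord w 0` is 0.
IsGap : List ℕ → ℕ → Set
IsGap w z = z / suc (length w) < coord w (z % suc (length w))

isGap? : ∀ w → Decidable (IsGap w)
isGap? w z = z / suc (length w) <? coord w (z % suc (length w))

gaps : List ℕ → List ℕ
gaps w = filter (isGap? w) (upTo (3 * suc (length w)))

gaps-increasing : ∀ w → AllPairs _<_ (gaps w)
gaps-increasing w = AllPairsₚ.filter⁺ (isGap? w)
  (AllPairsₚ.applyUpTo⁺₁ id (3 * suc (length w)) (λ i<j _ → i<j))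

-- The cutoff at `3 * m` in `gaps` loses nothing, because a quotient below a letter is below 3. The
-- length is a separate `n` so that the lemma applies to `kunzWord`, whose length equals `n` only
-- propositionally.
∈-gaps⇔ : ∀ {w n} → Letters w → length w ≡ n → ∀ {z} →
          z ∈ gaps w ⇔ z / suc n < coord w (z % suc n)
∈-gaps⇔ {w} L refl {z} = mk⇔
  (λ z∈ → proj₂ (∈-filter⁻ (isGap? w) {xs = upTo (3 * m)} z∈))
  (λ z< → ∈-filter⁺ (isGap? w) (∈-upTo⁺ (z<3m z<)) z<)
  where
  m = suc (length w)
  z<3m : IsGap w z → z < 3 * m
  z<3m z< = ≰⇒> λ 3m≤z → <⇒≱ (<-≤-trans z< (coord≤3 L (z % m)))
    (subst (_≤ z / m) (m*n/n≡m 3 m) (/-monoˡ-≤ m 3m≤z))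

cell⇔ : ∀ {w} → Letters w → ∀ {r} k → r ≤ length w →
        r + k * suc (length w) ∈ gaps w ⇔ k < coord w r
cell⇔ {w} L {r} k r≤ = subst₂ (λ q s → r + k * suc (length w) ∈ gaps w ⇔ q < coord w s)
  ([r+k*m]/m≡k k (s≤s r≤)) ([r+k*m]%m≡r k (s≤s r≤)) (∈-gaps⇔ L refl)

-- Gaps grouped by residue class, and the genus.

column : (m a r : ℕ) → List ℕ
column m a r = map (λ k → r + k * m) (upTo a)

∈-column⇔ : ∀ {m a r z} .{{_ : NonZero m}} → r < m →
            z ∈ column m a r ⇔ (z % m ≡ r × z / m < a)
∈-column⇔ {m} {a} {r} {z} r<m = mk⇔ forward backward
  where
  forward : z ∈ column m a r → z % m ≡ r × z / m < a
  forward z∈ with k , k∈ , refl ← ∈-map⁻ (λ k → r + k * m) z∈ =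
    [r+k*m]%m≡r k r<m , subst (_< a) (sym ([r+k*m]/m≡k k r<m)) (∈-upTo⁻ k∈)
  backward : z % m ≡ r × z / m < a → z ∈ column m a r
  backward (refl , z/m<a) = subst (_∈ column m a r) (sym (m≡m%n+[m/n]*n z m))
    (∈-map⁺ (λ k → r + k * m) (∈-upTo⁺ z/m<a))

-- The same gaps in another order, chosen so that their number is visibly the sum of the letters.
-- The modulus is a parameter because it must stay fixed while the word shrinks.
columns : ℕ → List ℕ → List ℕ
columns m []      = []
columns m (a ∷ w) = column m a (suc (length w)) ++ columns m w

length-columns : ∀ m w → length (columns m w) ≡ sum w
length-columns m []      = refl
length-columns m (a ∷ w) = trans (length-++ (column m a (suc (length w))))
  (cong₂ _+_ (trans (length-map _ (upTo a)) (length-upTo a)) (length-columns m w))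

∈-columns⇔ : ∀ {m} w .{{_ : NonZero m}} → length w < m → ∀ {z} →
             z ∈ columns m w ⇔ z / m < coord w (z % m)
∈-columns⇔ []                _   = mk⇔ (λ ()) (λ ())
∈-columns⇔ {m} (a ∷ w) l<m {z} = mk⇔ forward backward
  where
  r = suc (length w)
  rec = ∈-columns⇔ w (<⇒≤ l<m) {z}
  forward : z ∈ columns m (a ∷ w) → z / m < coord (a ∷ w) (z % m)
  forward z∈ with ∈-++⁻ (column m a r) z∈
  ... | inj₁ z∈ˡ = let z%m≡r , z/m<a = to (∈-column⇔ l<m) z∈ˡ in
    subst (z / m <_) (sym (trans (cong (coord (a ∷ w)) z%m≡r) (coord-last a w))) z/m<a
  ... | inj₂ z∈ʳ = let z< = to rec z∈ʳ in
    subst (z / m <_) (sym (coord-init a w (<⇒≢ (s≤s (coord-within w z<))))) z<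
  backward : z / m < coord (a ∷ w) (z % m) → z ∈ columns m (a ∷ w)
  backward z< with z % m ≟ r
  ... | yes z%m≡r = ∈-++⁺ˡ (from (∈-column⇔ l<m) (z%m≡r , z<))
  ... | no  _     = ∈-++⁺ʳ (column m a r) (from rec z<)

columns-unique : ∀ {m} w .{{_ : NonZero m}} → length w < m → Unique (columns m w)
columns-unique []      _   = []
columns-unique {m} (a ∷ w) l<m = Unique.++⁺
  (Unique.map⁺ (λ {j} {k} eq → *-cancelʳ-≡ j k m (+-cancelˡ-≡ (suc (length w)) _ _ eq)) (Unique.upTo⁺ a))
  (columns-unique w (<⇒≤ l<m))
  -- The first column has residue `suc (length w)`, the later ones at most `length w`.
  (λ (z∈ˡ , z∈ʳ) → 1+n≰n (subst (_≤ length w) (proj₁ (to (∈-column⇔ l<m) z∈ˡ))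
    (coord-within w (to (∈-columns⇔ w (<⇒≤ l<m)) z∈ʳ))))

genus-gaps : ∀ {w} → Letters w → genus (gaps w) ≡ sum w
genus-gaps {w} L = trans (≤-antisym
  (length-≤-⊆ (AllPairs.map <⇒≢ (gaps-increasing w)) (from ∈cols ∘ to ∈gaps))
  (length-≤-⊆ (columns-unique w ≤-refl) (from ∈gaps ∘ to ∈cols)))
  (length-columns (suc (length w)) w)
  where
  ∈gaps : ∀ {z} → z ∈ gaps w ⇔ IsGap w z
  ∈gaps = ∈-gaps⇔ L refl
  ∈cols : ∀ {z} → z ∈ columns (suc (length w)) w ⇔ IsGap w z
  ∈cols = ∈-columns⇔ w ≤-refl

-- The modulus is cell 1 of the empty class 0; each smaller positive number is cell 0 of a class
-- with letter at least 1.
multiplicity-gaps : ∀ {w} → Letters w → multiplicity (gaps w) ≡ suc (length w)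
multiplicity-gaps {w} L = multiplicity-unique (gaps w) (s≤s z≤n)
  (λ m∈ → n≮0 (subst (1 <_) (coord-zero w)
    (to (cell⇔ L 1 z≤n) (subst (_∈ gaps w) (sym (*-identityˡ _)) m∈))))
  (λ k 1≤k k<m → subst (_∈ gaps w) (+-identityʳ k)
    (from (cell⇔ L 0 (s≤s⁻¹ k<m)) (1≤coord L 1≤k (s≤s⁻¹ k<m))))

depth-gaps : ∀ {w} → Letters w → depth (gaps w) ≤ 3
depth-gaps {w} L = from (depth≤⇔ (gaps w) 3)
  (subst (λ m → conductor (gaps w) ≤ 3 * m) (sym (multiplicity-gaps L))
    (conductor-≤ (gaps w) λ z∈ → ∈-upTo⁻ (proj₁
      (∈-filter⁻ (isGap? w) {xs = upTo (3 * suc (length w))} z∈))))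

-- The multiplicity recovers the length, and each letter is the membership threshold of its class.
gaps-injective : ∀ {v w} → Letters v → Letters w → gaps v ≡ gaps w → v ≡ w
gaps-injective {v} {w} Lv Lw eq = coord-ext v w l≡ λ i →
  ≤-antisym (coord-≤ Lv Lw l≡ eq i) (coord-≤ Lw Lv (sym l≡) (sym eq) i)
  where
  l≡ : length v ≡ length w
  l≡ = suc-injective (trans (sym (multiplicity-gaps Lv))
    (trans (cong multiplicity eq) (multiplicity-gaps Lw)))
  coord-≤ : ∀ {v w} → Letters v → Letters w → length v ≡ length w → gaps v ≡ gaps w →
            ∀ i → coord v i ≤ coord w i
  -- If `w_i < v_i`, then `i + w_i * m` is a gap for `v` but not for `w`.
  coord-≤ {v} {w} Lv Lw l≡ eq i = ≮⇒≥ λ w<v →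
    let i≤ = coord-within v w<v in
    <-irrefl refl (to (cell⇔ Lw (coord w i) (subst (i ≤_) l≡ i≤))
      (subst₂ (λ m G → i + coord w i * suc m ∈ G) l≡ eq (from (cell⇔ Lv (coord w i) i≤) w<v)))

-- Subadditivity of the word against the gapset property.

kunz⇒gapset : ∀ {w} → Kunz w → IsGapset (gaps w)
kunz⇒gapset {w} (L , sub) = mkIsGapset (gaps-increasing w) (All.tabulate pos) splits
  where
  n = length w
  m = suc n
  pos : ∀ {z} → z ∈ gaps w → 1 ≤ z
  pos {zero}  0∈ = contradiction (subst (0 <_) (coord-zero w) (to (cell⇔ L 0 z≤n) 0∈)) (λ ())
  pos {suc z} _  = s≤s z≤n

  -- When two residues add up to at least `m`, neither is 0, so both have letters at least 1.
  carry : ∀ i j → m ≤ i + j → j ≤ n → 1 ≤ i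
  carry zero    j m≤j j≤n = contradiction j≤n (<⇒≱ m≤j)
  carry (suc i) _ _   _   = s≤s z≤n

  -- Non-gaps are closed under addition. Without a carry this is subadditivity. With a carry the
  -- quotient becomes `1 + a + b`, which is at least 3 and hence bounds any letter.
  sum-∉ : ∀ {i j a b} → i ≤ n → j ≤ n → coord w i ≤ a → coord w j ≤ b →
          (i + j) + (a + b) * m ∉ gaps w
  sum-∉ {i} {j} {a} {b} i≤n j≤n i≤a j≤b z∈ with i + j ≤? n
  ... | yes i+j≤n = <⇒≱ (to (cell⇔ L (a + b) i+j≤n) z∈) (≤-trans (sub i j) (+-mono-≤ i≤a j≤b))
  ... | no  i+j≰n = <⇒≱ (to (cell⇔ L (suc (a + b)) r≤n) (subst (_∈ gaps w) regroup z∈))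
    (≤-trans (coord≤3 L r) (s≤s (+-mono-≤
      (≤-trans (1≤coord L (carry i j m≤i+j j≤n) i≤n) i≤a)
      (≤-trans (1≤coord L (carry j i (subst (m ≤_) (+-comm i j) m≤i+j) i≤n) j≤n) j≤b))))
    where
    m≤i+j : m ≤ i + j
    m≤i+j = ≰⇒> i+j≰n
    r = i + j ∸ m
    r≤n : r ≤ n
    r≤n = m≤n+o⇒m∸n≤o (i + j) m (≤-trans (+-mono-≤ i≤n j≤n) (n≤1+n _))
    regroup : (i + j) + (a + b) * m ≡ r + suc (a + b) * m
    regroup = trans (cong (_+ (a + b) * m) (sym (m∸n+n≡m m≤i+j))) (+-assoc r m ((a + b) * m))

  splits : ∀ {z} → z ∈ gaps w → ∀ x y → 1 ≤ x → 1 ≤ y → z ≡ x + y → x ∈ gaps w ⊎ y ∈ gaps w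
  splits z∈ x y _ _ refl with x / m <? coord w (x % m) | y / m <? coord w (y % m)
  ... | yes x< | _      = inj₁ (from (∈-gaps⇔ L refl) x<)
  ... | no _   | yes y< = inj₂ (from (∈-gaps⇔ L refl) y<)
  ... | no x≮  | no y≮  = contradiction (subst (_∈ gaps w) regroup z∈)
    (sum-∉ (s≤s⁻¹ (m%n<n x m)) (s≤s⁻¹ (m%n<n y m)) (≮⇒≥ x≮) (≮⇒≥ y≮))
    where
    regroup : x + y ≡ (x % m + y % m) + (x / m + y / m) * m
    regroup = trans (cong₂ _+_ (m≡m%n+[m/n]*n x m) (m≡m%n+[m/n]*n y m))
      (trans (interchange (x % m) (x / m * m) (y % m) (y / m * m))
        (cong (x % m + y % m +_) (sym (*-distribʳ-+ m (x / m) (y / m)))))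

-- `i + w_i * m` and `j + w_j * m` are the first non-gaps of their classes. Were `w_{i+j}` larger
-- than `w_i + w_j`, their sum would be a gap split into two non-gaps.
gapset⇒subadditive : ∀ {w} → Letters w → IsGapset (gaps w) → Subadditive w
gapset⇒subadditive {w} L γ zero    j = m≤n+m _ _
gapset⇒subadditive {w} L γ (suc i) zero rewrite +-identityʳ i = m≤m+n _ _
gapset⇒subadditive {w} L γ i@(suc _) j@(suc _) = ≮⇒≥ λ sum< →
  let i+j≤n = coord-within w sum< in
  [ (λ x∈ → <-irrefl refl (to (cell⇔ L (coord w i) (m+n≤o⇒m≤o i i+j≤n)) x∈))
  , (λ y∈ → <-irrefl refl (to (cell⇔ L (coord w j) (m+n≤o⇒n≤o i i+j≤n)) y∈))
  ]′ (IsGapset.splits γ (from (cell⇔ L (coord w i + coord w j) i+j≤n) sum<)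
        (i + coord w i * m) (j + coord w j * m) (s≤s z≤n) (s≤s z≤n)
        (trans (cong (i + j +_) (*-distribʳ-+ m (coord w i) (coord w j)))
               (interchange i j (coord w i * m) (coord w j * m))))
  where m = suc (length w)

-- `Subadditive` quantifies over all naturals, so it is decided through the equivalent gapset
-- property.
kunz? : ∀ w → Dec (Kunz w)
kunz? w with All.all? (λ a → 1 ≤? a ×-dec a ≤? 3) w
... | no ¬L = no (¬L ∘ proj₁)
... | yes L = map′ (λ γ → L , gapset⇒subadditive L γ) kunz⇒gapset (isGapset? (gaps w))

-- From gapsets to words

module _ {G} (γ : IsGapset G) (d≤3 : depth G ≤ 3) where
  open IsGapset γ

  private
    n = pred (multiplicity G)
    m = suc n

  subtract-m : ∀ x → m + x ∈ G → x ∈ G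
  subtract-m zero    m∈ = contradiction (subst (_∈ G) (+-identityʳ m) m∈) (multiplicity-∉ G)
  subtract-m (suc x) z∈ with splits z∈ m (suc x) (s≤s z≤n) (s≤s z≤n) refl
  ... | inj₁ m∈ = contradiction m∈ (multiplicity-∉ G)
  ... | inj₂ x∈ = x∈

  residueClass : ∀ r → ∃[ t ] t ≤ 3 × (∀ {k} → r + k * m ∈ G ⇔ k < t)
  residueClass r = initial-segment (λ k → r + k * m ∈? G)
    (λ {k} z∈ → subtract-m (r + k * m) (subst (_∈ G) (shift k) z∈)) 3
    -- `r + 3 * m` is never in `G`, since the depth bound gives a conductor of at most `3 * m`.
    (λ z∈ → <⇒≱ (∈⇒<conductor z∈) (≤-trans (to (depth≤⇔ G 3) d≤3) (m≤n+m (3 * m) r)))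
    where
    shift : ∀ k → r + suc k * m ≡ m + (r + k * m)
    shift k = trans (sym (+-assoc r m (k * m)))
      (trans (cong (_+ k * m) (+-comm r m)) (+-assoc m r (k * m)))

  -- For `r < m` this is the number of elements of `G` congruent to `r`, its Kunz coordinate.
  height : ℕ → ℕ
  height r = proj₁ (residueClass r)

  height⇔ : ∀ r {k} → r + k * m ∈ G ⇔ k < height r
  height⇔ r = proj₂ (proj₂ (residueClass r))

  height-zero : height 0 ≡ 0
  height-zero = n≤0⇒n≡0 (≮⇒≥ λ 0<h → 1+n≰n (All.lookup positive (from (height⇔ 0) 0<h)))

  kunzWord : List ℕ
  kunzWord = word height n

  letters-kunzWord : Letters kunzWord
  letters-kunzWord = letters-word height n λ i 1≤i i≤n →
    to (height⇔ i) (subst (_∈ G) (sym (+-identityʳ i)) (multiplicity-least G i 1≤i (s≤s i≤n))) ,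
    proj₁ (proj₂ (residueClass i))

  coord-kunzWord : ∀ {r} → r ≤ n → coord kunzWord r ≡ height r
  coord-kunzWord {zero}  _   = trans (coord-zero kunzWord) (sym height-zero)
  coord-kunzWord {suc r} r≤n = coord-word height n (s≤s z≤n) r≤n

  gaps-kunzWord : gaps kunzWord ≡ G
  gaps-kunzWord = increasing-ext (gaps-increasing kunzWord) increasing
    (λ z∈ → from ∈G⇔ (to ∈gaps z∈)) (λ z∈ → from ∈gaps (to ∈G⇔ z∈))
    where
    ∈gaps : ∀ {z} → z ∈ gaps kunzWord ⇔ z / m < coord kunzWord (z % m)
    ∈gaps = ∈-gaps⇔ letters-kunzWord (length-word height n)
    ∈G⇔ : ∀ {z} → z ∈ G ⇔ z / m < coord kunzWord (z % m)
    ∈G⇔ {z} = subst₂ (λ x h → x ∈ G ⇔ z / m < h) (sym (m≡m%n+[m/n]*n z m))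
      (sym (coord-kunzWord (s≤s⁻¹ (m%n<n z m)))) (height⇔ (z % m))

  kunz-kunzWord : Kunz kunzWord
  kunz-kunzWord = letters-kunzWord ,
    gapset⇒subadditive letters-kunzWord (subst IsGapset (sym gaps-kunzWord) γ)

-- Enumeration of the words with a given sum

-- Words are sorted by their last letter, stored first. `words₂ g` and `words₃ g` hold the words of
-- sum `suc g` ending in 2 and 3, a shift that keeps the recursion structural. Only an appended 3
-- can break subadditivity, so only `words₃` filters.
mutual
  words : ℕ → List (List ℕ)
  words zero    = [] ∷ []
  words (suc g) = map (1 ∷_) (words g) ++ (words₂ g ++ words₃ g)

  words₂ : ℕ → List (List ℕ)
  words₂ zero    = []
  words₂ (suc g) = map (2 ∷_) (words g)

  words₃ : ℕ → List (List ℕ)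
  words₃ (suc (suc g)) = filter kunz? (map (3 ∷_) (words g))
  words₃ _             = []

∈-words₂⁻ : ∀ g {w} → w ∈ words₂ g → ∃[ v ] w ≡ 2 ∷ v
∈-words₂⁻ (suc g) w∈ with v , _ , w≡ ← ∈-map⁻ (2 ∷_) w∈ = v , w≡

∈-words₃⁻ : ∀ g {w} → w ∈ words₃ g → ∃[ v ] w ≡ 3 ∷ v
∈-words₃⁻ (suc (suc g)) w∈
  with v , _ , w≡ ← ∈-map⁻ (3 ∷_) (proj₁ (∈-filter⁻ kunz? {xs = map (3 ∷_) (words g)} w∈)) = v , w≡

mutual
  words-unique : ∀ g → Unique (words g)
  words-unique zero    = [] ∷ []
  words-unique (suc g) = Unique.++⁺ (Unique.map⁺ ∷-injectiveʳ (words-unique g))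
    (Unique.++⁺ (words₂-unique g) (words₃-unique g) λ (∈₂ , ∈₃) → 2≢3 (∈-words₂⁻ g ∈₂) (∈-words₃⁻ g ∈₃))
    λ (∈₁ , ∈₂₃) → 1≢2,3 (∈-map⁻ (1 ∷_) ∈₁) (∈-++⁻ (words₂ g) ∈₂₃)
    where
    2≢3 : ∀ {w : List ℕ} → (∃[ v ] w ≡ 2 ∷ v) → ¬ (∃[ v ] w ≡ 3 ∷ v)
    2≢3 (u , refl) (v , ())
    1≢2,3 : ∀ {w} → (∃[ v ] v ∈ words g × w ≡ 1 ∷ v) → ¬ (w ∈ words₂ g ⊎ w ∈ words₃ g)
    1≢2,3 (_ , _ , refl) (inj₁ ∈₂) with () ← proj₂ (∈-words₂⁻ g ∈₂)
    1≢2,3 (_ , _ , refl) (inj₂ ∈₃) with () ← proj₂ (∈-words₃⁻ g ∈₃)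

  words₂-unique : ∀ g → Unique (words₂ g)
  words₂-unique zero    = []
  words₂-unique (suc g) = Unique.map⁺ ∷-injectiveʳ (words-unique g)

  words₃-unique : ∀ g → Unique (words₃ g)
  words₃-unique zero          = []
  words₃-unique (suc zero)    = []
  words₃-unique (suc (suc g)) = Unique.filter⁺ kunz? (Unique.map⁺ ∷-injectiveʳ (words-unique g))

mutual
  words-sound : ∀ g {w} → w ∈ words g → Kunz w × sum w ≡ g
  words-sound zero    (here refl) = ([] , λ _ _ → z≤n) , refl
  words-sound (suc g) w∈ with ∈-++⁻ (map (1 ∷_) (words g)) w∈
  ... | inj₂ w∈₂₃ = [ words₂-sound g , words₃-sound g ]′ (∈-++⁻ (words₂ g) w∈₂₃)
  ... | inj₁ w∈₁ with v , v∈ , refl ← ∈-map⁻ (1 ∷_) w∈₁ =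
    let κ , Σ≡ = words-sound g v∈ in kunz-cons (s≤s z≤n) (s≤s z≤n) κ , cong suc Σ≡

  words₂-sound : ∀ g {w} → w ∈ words₂ g → Kunz w × sum w ≡ suc g
  words₂-sound (suc g) w∈ with v , v∈ , refl ← ∈-map⁻ (2 ∷_) w∈ =
    let κ , Σ≡ = words-sound g v∈ in kunz-cons (s≤s z≤n) ≤-refl κ , cong (2 +_) Σ≡

  words₃-sound : ∀ g {w} → w ∈ words₃ g → Kunz w × sum w ≡ suc g
  words₃-sound (suc (suc g)) w∈
    with w∈′ , κ ← ∈-filter⁻ kunz? {xs = map (3 ∷_) (words g)} w∈
    with v , v∈ , refl ← ∈-map⁻ (3 ∷_) w∈′ = κ , cong (3 +_) (proj₂ (words-sound g v∈))

-- Induction on the word, which works because deleting the last letter preserves `Kunz`.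
words-complete : ∀ {w} → Kunz w → w ∈ words (sum w)
words-complete {[]} _ = here refl
words-complete {0 ∷ w} (((() , _) ∷ _) , _)
words-complete {1 ∷ w} κ = ∈-++⁺ˡ (∈-map⁺ (1 ∷_) (words-complete (kunz-init κ)))
words-complete {2 ∷ w} κ = ∈-++⁺ʳ (map (1 ∷_) (words (suc (sum w))))
  (∈-++⁺ˡ (∈-map⁺ (2 ∷_) (words-complete (kunz-init κ))))
words-complete {3 ∷ w} κ = ∈-++⁺ʳ (map (1 ∷_) (words (2 + sum w)))
  (∈-++⁺ʳ (words₂ (2 + sum w)) (∈-filter⁺ kunz? (∈-map⁺ (3 ∷_) (words-complete (kunz-init κ))) κ))
words-complete {suc (suc (suc (suc a))) ∷ w} (((_ , s≤s (s≤s (s≤s ()))) ∷ _) , _)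

-- Counting gapsets by words and the two bounds.

n'≡length-words : ∀ g → n' g ≡ length (words g)
n'≡length-words g = ≤-antisym n'≤ n'≥
  where
  kunz : ∀ {w} → w ∈ words g → Kunz w
  kunz w∈ = proj₁ (words-sound g w∈)
  n'≥ : length (words g) ≤ n' g
  n'≥ = length-≤-injection gaps (words-unique g)
    (λ w∈ → let κ , Σ≡ = words-sound g w∈ in from (∈-gapsetsDepth≤3⇔ g _)
      (kunz⇒gapset κ , trans (genus-gaps (proj₁ κ)) Σ≡ , depth-gaps (proj₁ κ)))
    (λ v∈ w∈ → gaps-injective (proj₁ (kunz v∈)) (proj₁ (kunz w∈)))
  gapset∈ : gapsetsDepth≤3 g ⊆ map gaps (words g)
  -- Every counted gapset is `gaps` of its own `kunzWord`, whose letter sum is the genus.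
  gapset∈ {G} G∈ with γ , genus≡ , d≤3 ← to (∈-gapsetsDepth≤3⇔ g G) G∈ =
    subst (_∈ map gaps (words g)) (gaps-kunzWord γ d≤3) (∈-map⁺ gaps
      (subst (λ k → kunzWord γ d≤3 ∈ words k)
        (trans (sym (genus-gaps (letters-kunzWord γ d≤3))) (trans (cong genus (gaps-kunzWord γ d≤3)) genus≡))
        (words-complete (kunz-kunzWord γ d≤3))))
  n'≤ : n' g ≤ length (words g)
  n'≤ = subst (n' g ≤_) (length-map gaps (words g))
    (length-≤-⊆ (gapsetsDepth≤3-unique g) gapset∈)

-- A Fibonacci recurrence with an error term counting the words that end in 3; both bounds come from
-- estimating that term.
length-words : ∀ g → length (words (3 + g)) ≡
               length (words (2 + g)) + length (words (1 + g)) + length (words₃ (2 + g))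
length-words g = begin
  length (map (1 ∷_) w₁ ++ (map (2 ∷_) w₂ ++ w₃))
    ≡⟨ length-++ (map (1 ∷_) w₁) ⟩
  length (map (1 ∷_) w₁) + length (map (2 ∷_) w₂ ++ w₃)
    ≡⟨ cong₂ _+_ (length-map _ w₁) (trans (length-++ (map (2 ∷_) w₂)) (cong (_+ length w₃) (length-map _ w₂))) ⟩
  length w₁ + (length w₂ + length w₃)
    ≡⟨ +-assoc (length w₁) (length w₂) (length w₃) ⟨
  length w₁ + length w₂ + length w₃
    ∎
  where
  open ≡-Reasoning
  w₁ = words (2 + g)
  w₂ = words (1 + g)
  w₃ = words₃ (2 + g)

mainTheorem1 : ∀ (g : ℕ) → 3 ≤ g →
    (n' (g ∸ 1) + n' (g ∸ 2) ≤ n' g) ×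
    (n' g ≤ n' (g ∸ 1) + n' (g ∸ 2) + n' (g ∸ 3))
mainTheorem1 (suc (suc (suc g))) (s≤s (s≤s (s≤s z≤n))) =
  (begin
    n' (2 + g) + n' (1 + g)    ≡⟨ cong₂ _+_ (n'≡length-words (2 + g)) (n'≡length-words (1 + g)) ⟩
    w₁ + w₂                    ≤⟨ m≤m+n (w₁ + w₂) w₃ ⟩
    w₁ + w₂ + w₃               ≡⟨ length-words g ⟨
    length (words (3 + g))     ≡⟨ n'≡length-words (3 + g) ⟨
    n' (3 + g)                 ∎) ,
  (begin
    n' (3 + g)                 ≡⟨ n'≡length-words (3 + g) ⟩
    length (words (3 + g))     ≡⟨ length-words g ⟩
    -- Words ending in 3 are a filtered part of all words of sum `g` with a 3 appended.
    w₁ + w₂ + w₃               ≤⟨ +-monoʳ-≤ (w₁ + w₂) (length-filter kunz? (map (3 ∷_) (words g))) ⟩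
    w₁ + w₂ + length (map (3 ∷_) (words g))
      ≡⟨ cong (w₁ + w₂ +_) (length-map (3 ∷_) (words g)) ⟩
    w₁ + w₂ + length (words g)
      ≡⟨ cong₂ _+_ (cong₂ _+_ (n'≡length-words (2 + g)) (n'≡length-words (1 + g))) (n'≡length-words g) ⟨
    n' (2 + g) + n' (1 + g) + n' g ∎)
  where
  open ≤-Reasoning
  w₁ = length (words (2 + g))
  w₂ = length (words (1 + g))
  w₃ = length (words₃ (2 + g))
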